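{- For any tiling system $\tau$, the set of slopes $\mathrm{Sl}_\tau\subseteq\mathbb{Q}\cup\{\infty\}$ is recursively enumerable.
   Context: A tiling system is a pair $(T,F)$ where $T$ is a finite set of tiles and $F$ is a finite set of finite patterns; a pattern with support $N\subseteq\mathbb{Z}^2$ is a map $N\to T$. A tiling is a map $c:\mathbb{Z}^2\to T$; it is valid for $(T,F)$ if no pattern of $F$ appears in $c$ (i.e. for no $P\in F$ with support $N$ and no $u\in\mathbb{Z}^2$ does $c(u+x)=P(x)$ hold for all $x\in N$). A tiling $c$ is periodic of period $v=(v_x,v_y)\in\mathbb{Z}^2$ if $c(x,y)=c(x+v_x,y+v_y)$ for all $x,y\in\mathbb{Z}$. The direction of $v\neq(0,0)$ is $v_y/v_x\in\mathbb{Q}\cup\{\infty\}$, with the convention that it is $\infty$ if $v_x=0$. A tiling is periodic along direction $\theta$ if it is periodic of some period $v\neq(0,0)$ of direction $\theta$. If a tiling is periodic along exactly one direction $\theta$, then $\theta$ is called the slope of the tiling. The set of slopes $\mathrm{Sl}_\tau$ of $\tau$ is the set of slopes of all valid tilings by $\tau$. A set $S\subseteq\mathbb{Q}\cup\{\infty\}$ is recursively enumerable if there exists a Turing machine that, on input $(p,q)\in\mathbb{Z}^2\setminus\{(0,0)\}$, halts if and only if $q/p\in S$ (with $q/p=\infty$ when $p=0$). -}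

module Defs where

open import Data.Nat using (ℕ; suc)
open import Data.Integer using (ℤ; +_; -[1+_]; -_) renaming (_+_ to _+ℤ_)
open import Data.Rational using (ℚ; _/_)
open import Data.Fin using (Fin)
open import Data.Bool using (Bool; true)
open import Data.List using (List)
open import Data.List.Relation.Unary.All using (All)
open import Data.List.Relation.Unary.Any using (Any)
open import Data.Product using (Σ; ∃; _×_; _,_; proj₁; proj₂)
open import Relation.Binary.PropositionalEquality using (_≡_)
open import Relation.Nullary using (¬_)
open import Function.Bundles using (_⇔_)

ℤ² : Set
ℤ² = ℤ × ℤ

_⊕_ : ℤ² → ℤ² → ℤ²
(a , b) ⊕ (c , d) = (a +ℤ c , b +ℤ d)

-- A pattern over the tile set Fin k: a finite support N (given as a list)
-- together with an assignment of tiles; only its values on N matter.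
record Pattern (k : ℕ) : Set where
  field
    support : List ℤ²
    tileAt  : ℤ² → Fin k
open Pattern public

-- A tiling system: tiles T = Fin k (any finite set), finite set F of forbidden patterns.
record TilingSystem : Set where
  field
    k         : ℕ
    forbidden : List (Pattern k)
open TilingSystem public

Tiling : TilingSystem → Set
Tiling τ = ℤ² → Fin (k τ)

AppearsAt : ∀ {n} → (ℤ² → Fin n) → Pattern n → ℤ² → Set
AppearsAt c P u = All (λ x → c (u ⊕ x) ≡ tileAt P x) (support P)

Valid : (τ : TilingSystem) → Tiling τ → Set
Valid τ c = All (λ P → ∀ u → ¬ AppearsAt c P u) (forbidden τ)

data Dir : Set where
  fin : ℚ → Dir
  ∞   : Dir

dir : ℤ → ℤ → Dir
dir (+ 0)      q = ∞
dir (+ suc n)  q = fin (q / suc n)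
dir -[1+ n ]   q = fin ((- q) / suc n)

NonZeroVec : ℤ² → Set
NonZeroVec (p , q) = ¬ (p ≡ + 0 × q ≡ + 0)

PeriodicOf : ∀ {n} → (ℤ² → Fin n) → ℤ² → Set
PeriodicOf c v = ∀ x y → c (x , y) ≡ c ((x , y) ⊕ v)

PeriodicAlong : ∀ {n} → (ℤ² → Fin n) → Dir → Set
PeriodicAlong c θ = Σ ℤ² λ v → NonZeroVec v × PeriodicOf c v × (dir (proj₁ v) (proj₂ v) ≡ θ)

IsSlope : ∀ {n} → (ℤ² → Fin n) → Dir → Set
IsSlope c θ = PeriodicAlong c θ × (∀ θ' → PeriodicAlong c θ' → θ' ≡ θ)

Slopes : TilingSystem → Dir → Set
Slopes τ θ = Σ (Tiling τ) λ c → Valid τ c × IsSlope c θ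

-- Recursive enumerability, rendered synthetically: a (necessarily computable,
-- since constructed in --safe Agda) step-indexed semi-decider f p q n
-- ("the machine on input (p,q) has halted within n steps").
RecEnum : (Dir → Set) → Set
RecEnum S = Σ (ℤ → ℤ → ℕ → Bool) λ f →
  ∀ p q → NonZeroVec (p , q) → (S (dir p q) ⇔ ∃ λ n → f p q n ≡ true)

-- A tiling has slope q/p (p > 0) iff it has a period k(p, q) and every period is parallel to it.
-- A tiling with period (A, b) is the same as a bi-infinite sequence of rows of length A, validity
-- becomes a local condition on that sequence, and the tiling has exactly one period direction iff
-- the sequence is aperiodic. Whether a one-dimensional subshift of finite type has an aperiodic
-- point is decidable: it has one iff it has one of the shape ⋯uuu v www⋯ with u, v, w of length
-- bounded by the number of windows (pigeonhole). Searching through the multiples k therefore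
-- semi-decides Sl_τ; the vertical slope reduces to a horizontal one by transposing.
module Submission where

open import Data.Bool using (Bool; true; false)
open import Data.Empty using (⊥-elim)
open import Data.Fin using (Fin; toℕ; fromℕ<)
import Data.Fin.Properties as Finₚ
open import Data.Integer as ℤ using (ℤ; +_; -[1+_]; _+_; _*_; -_; _-_)
open import Data.Integer.DivMod using (_%ℕ_; _/ℕ_; n%ℕd<d; a≡a%ℕn+[a/ℕn]*n)
import Data.Integer.Properties as ℤₚ
open import Data.Integer.Tactic.RingSolver using (solve-∀)
open import Data.List as List using (List; []; _∷_; length)
open import Data.List.Extrema.Nat using (max; xs≤max)
open import Data.List.Membership.Propositional using (_∈_)
open import Data.List.Membership.Propositional.Properties using (∈-cartesianProductWith⁺; ∈-map⁺; ∈-allFin)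
import Data.List.Membership.Setoid.Properties as Membershipₛ
open import Data.List.Relation.Unary.All as All using (All)
import Data.List.Relation.Unary.All.Properties as Allₚ
open import Data.List.Relation.Unary.Any as Any using (here)
open import Data.Nat as ℕ using (ℕ; zero; suc; _≤_; _<_; z≤n; s≤s)
open import Data.Nat.DivMod using (m<n⇒m%n≡m; m<n⇒m/n≡0)
open import Data.Nat.Induction using (<-rec)
import Data.Nat.Properties as ℕₚ
import Data.Nat.Tactic.RingSolver as ℕ-Solver
open import Data.Product using (Σ; ∃; _×_; _,_; proj₁; proj₂; swap)
open import Data.Rational using (_/_)
import Data.Rational.Properties as ℚₚ
open import Data.Rational.Unnormalised using (mkℚᵘ; *≡*) renaming (_≃_ to _≃ᵘ_)
open import Data.Sum using (_⊎_; inj₁; inj₂)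
open import Data.Vec as Vec using (Vec; lookup; tabulate)
import Data.Vec.Properties as Vecₚ
open import Function.Base using (_∘_; case_of_)
open import Function.Bundles using (_⇔_; mk⇔; Equivalence)
import Function.Properties.Equivalence as ⇔
open import Relation.Binary.Definitions using (DecidableEquality)
open import Relation.Binary.PropositionalEquality
open import Relation.Nullary using (¬_; Dec; yes; no; does)
open import Relation.Nullary.Decidable using (_×-dec_; _⊎-dec_; ¬?; decidable-stable; dec-true)

open import Defs

-- Euclidean division by a positive natural number

private
  move-multiple : ∀ r r' q q' d → r + q * d ≡ r' + q' * d → r ≡ r' + (q' - q) * d
  move-multiple r r' q q' d eq = begin
    r                   ≡⟨ cancel r q d ⟩
    r + q * d - q * d   ≡⟨ cong (_- q * d) eq ⟩
    r' + q' * d - q * d ≡⟨ regroup r' q q' d ⟩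
    r' + (q' - q) * d   ∎
    where
    open ≡-Reasoning
    cancel : ∀ r q d → r ≡ r + q * d - q * d
    cancel = solve-∀
    regroup : ∀ r' q q' d → r' + q' * d - q * d ≡ r' + (q' - q) * d
    regroup = solve-∀

  quotients-differ-by-pos : ∀ {d r} r' (q q' : ℤ) n → r < d → q' - q ≡ + suc n →
                            + r + q * + d ≢ + r' + q' * + d
  quotients-differ-by-pos {d} {r} r' q q' n r<d e eq = ℕₚ.<⇒≱ r<d (begin
    d                  ≤⟨ ℕₚ.m≤n*m d (suc n) ⟩
    suc n ℕ.* d        ≤⟨ ℕₚ.m≤n+m _ r' ⟩
    r' ℕ.+ suc n ℕ.* d ≡⟨ ℤₚ.+-injective r≡ ⟨
    r                  ∎)
    where
    open ℕₚ.≤-Reasoning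
    r≡ : + r ≡ + (r' ℕ.+ suc n ℕ.* d)
    r≡ = trans (move-multiple (+ r) (+ r') q q' (+ d) eq)
        (trans (cong (λ z → + r' + z * + d) e)
        (sym (trans (ℤₚ.pos-+ r' _) (cong (λ z → + r' + z) (ℤₚ.pos-* (suc n) d)))))

divMod-unique : ∀ {d r r'} (q q' : ℤ) → r < d → r' < d →
                + r + q * + d ≡ + r' + q' * + d → r ≡ r' × q ≡ q'
divMod-unique {d} {r} {r'} q q' r<d r'<d eq with q' - q in e
... | + zero   = ℤₚ.+-injective r≡r' , q≡q'
  where
  q≡q' : q ≡ q'
  q≡q' = sym (ℤₚ.i-j≡0⇒i≡j q' q e)
  r≡r' : + r ≡ + r'
  r≡r' = trans (move-multiple (+ r) (+ r') q q' (+ d) eq)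
         (trans (cong (λ z → + r' + z * + d) e) (ℤₚ.+-identityʳ (+ r')))
... | + suc n  = ⊥-elim (quotients-differ-by-pos r' q q' n r<d e eq)
... | -[1+ n ] = ⊥-elim (quotients-differ-by-pos r q' q n r'<d e′ (sym eq))
  where
  e′ : q - q' ≡ + suc n
  e′ = trans (sym (negate-minus q' q)) (cong -_ e)
    where
    negate-minus : ∀ a b → - (a - b) ≡ b - a
    negate-minus = solve-∀

module _ (d : ℕ) .{{_ : ℕ.NonZero d}} where

  %ℕ-/ℕ-unique : ∀ n r q → r < d → n ≡ + r + q * + d → n %ℕ d ≡ r × n /ℕ d ≡ q
  %ℕ-/ℕ-unique n r q r<d eq =
    divMod-unique (n /ℕ d) q (n%ℕd<d n d) r<d (trans (sym (a≡a%ℕn+[a/ℕn]*n n d)) eq)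

  private
    [n+q*d]-divMod : ∀ n q → (n + q * + d) %ℕ d ≡ n %ℕ d × (n + q * + d) /ℕ d ≡ n /ℕ d + q
    [n+q*d]-divMod n q = %ℕ-/ℕ-unique (n + q * + d) (n %ℕ d) (n /ℕ d + q) (n%ℕd<d n d)
      (trans (cong (_+ q * + d) (a≡a%ℕn+[a/ℕn]*n n d)) (regroup (+ (n %ℕ d)) (n /ℕ d) q (+ d)))
      where
      regroup : ∀ r a b d → r + a * d + b * d ≡ r + (a + b) * d
      regroup = solve-∀

  [n+q*d]%ℕd≡n%ℕd : ∀ n q → (n + q * + d) %ℕ d ≡ n %ℕ d
  [n+q*d]%ℕd≡n%ℕd n q = proj₁ ([n+q*d]-divMod n q)

  [n+q*d]/ℕd≡n/ℕd+q : ∀ n q → (n + q * + d) /ℕ d ≡ n /ℕ d + q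
  [n+q*d]/ℕd≡n/ℕd+q n q = proj₂ ([n+q*d]-divMod n q)

-- Directions

private
  ≡⇔≡ : ∀ {a a' b b' : ℤ} → a ≡ a' → b ≡ b' → (a ≡ b) ⇔ (a' ≡ b')
  ≡⇔≡ refl refl = ⇔.refl

  ≡⇔neg≡neg : ∀ {a b : ℤ} → (a ≡ b) ⇔ (- a ≡ - b)
  ≡⇔neg≡neg = mk⇔ (cong (λ z → - z)) ℤₚ.neg-injective

  cross-negʳ : ∀ x d b y → (x * - d ≡ b * y) ⇔ (x * d ≡ b * - y)
  cross-negʳ x d b y = ⇔.trans ≡⇔neg≡neg (≡⇔≡ (negneg x d) (ℤₚ.neg-distribʳ-* b y))
    where
    negneg : ∀ x d → - (x * - d) ≡ x * d
    negneg = solve-∀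

  cross-negˡ : ∀ x d b y → (x * d ≡ - b * y) ⇔ (- x * d ≡ b * y)
  cross-negˡ x d b y = ⇔.trans ≡⇔neg≡neg (≡⇔≡ (ℤₚ.neg-distribˡ-* x d) (negneg b y))
    where
    negneg : ∀ b y → - (- b * y) ≡ b * y
    negneg = solve-∀

  fin-≡ : ∀ {x y} → fin x ≡ fin y ⇔ x ≡ y
  fin-≡ = mk⇔ (λ { refl → refl }) (cong fin)

  /-≡ : ∀ x m y n → x / suc m ≡ y / suc n ⇔ x * + suc n ≡ y * + suc m
  /-≡ x m y n = mk⇔ (λ eq → cross (ℚₚ.fromℚᵘ-injective {mkℚᵘ x m} {mkℚᵘ y n} eq))
                    (λ eq → ℚₚ.fromℚᵘ-cong {mkℚᵘ x m} {mkℚᵘ y n} (*≡* eq))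
    where
    cross : mkℚᵘ x m ≃ᵘ mkℚᵘ y n → x * + suc n ≡ y * + suc m
    cross (*≡* eq) = eq

  dir-cross⁺⁺ : ∀ m b n d → dir (+ suc m) b ≡ dir (+ suc n) d ⇔ + suc m * d ≡ b * + suc n
  dir-cross⁺⁺ m b n d = ⇔.trans fin-≡ (⇔.trans (/-≡ b m d n)
    (mk⇔ (λ eq → trans (ℤₚ.*-comm (+ suc m) d) (sym eq)) (λ eq → sym (trans (ℤₚ.*-comm d (+ suc m)) eq))))

  nonzero-product : ∀ {a d} → a ≢ + 0 → d ≢ + 0 → a * d ≢ + 0
  nonzero-product {a} a≢0 d≢0 eq with ℤₚ.i*j≡0⇒i≡0∨j≡0 a eq
  ... | inj₁ a≡0 = a≢0 a≡0
  ... | inj₂ d≡0 = d≢0 d≡0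

  dir-cross⁺ : ∀ m b c d → NonZeroVec (c , d) → dir (+ suc m) b ≡ dir c d ⇔ + suc m * d ≡ b * c
  dir-cross⁺ m b (+ zero)  d nz = mk⇔ (λ ()) λ eq →
    ⊥-elim (nonzero-product {+ suc m} (λ ()) (λ d≡0 → nz (refl , d≡0)) (trans eq (ℤₚ.*-zeroʳ b)))
  dir-cross⁺ m b (+ suc n) d nz = dir-cross⁺⁺ m b n d
  dir-cross⁺ m b -[1+ n ]  d nz = ⇔.trans (dir-cross⁺⁺ m b n (- d)) (cross-negʳ (+ suc m) d b (+ suc n))

dir-cross : ∀ a b c d → NonZeroVec (a , b) → NonZeroVec (c , d) → dir a b ≡ dir c d ⇔ a * d ≡ b * c
dir-cross (+ zero)  b (+ zero)  d _ _ = mk⇔ (λ _ → sym (ℤₚ.*-zeroʳ b)) (λ _ → refl)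
dir-cross (+ zero)  b (+ suc n) d nz _ = mk⇔ (λ ()) λ eq →
  ⊥-elim (nonzero-product {b} {+ suc n} (λ b≡0 → nz (refl , b≡0)) (λ ()) (sym eq))
dir-cross (+ zero)  b -[1+ n ]  d nz _ = mk⇔ (λ ()) λ eq →
  ⊥-elim (nonzero-product {b} { -[1+ n ]} (λ b≡0 → nz (refl , b≡0)) (λ ()) (sym eq))
dir-cross (+ suc m) b c d _ nz = dir-cross⁺ m b c d nz
dir-cross -[1+ m ]  b c d _ nz = ⇔.trans (dir-cross⁺ m (- b) c d nz) (cross-negˡ (+ suc m) d b c)

dir-swap : ∀ {a b c d} → NonZeroVec (a , b) → NonZeroVec (c , d) → dir a b ≡ dir c d → dir b a ≡ dir d c
dir-swap {a} {b} {c} {d} ab≢0 cd≢0 eq = Equivalence.from (dir-cross b a d c (ab≢0 ∘ swap) (cd≢0 ∘ swap))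
  (sym (Equivalence.to (dir-cross a b c d ab≢0 cd≢0) eq))

dir-scale : ∀ m n q → dir (+ suc m * + suc n) (+ suc m * q) ≡ dir (+ suc n) q
dir-scale m n q = Equivalence.from (dir-cross (+ suc m * + suc n) (+ suc m * q) (+ suc n) q (λ { (() , _) }) (λ { (() , _) }))
  (rearrange (+ suc m) (+ suc n) q)
  where
  rearrange : ∀ k a b → k * a * b ≡ k * b * a
  rearrange = solve-∀

-- Periods of two-dimensional configurations

infixr 7 _·_
_·_ : ℤ → ℤ² → ℤ²
k · (a , b) = (k * a , k * b)

module _ {n} (c : ℤ² → Fin n) where

  periodic-at : ∀ {v} → PeriodicOf c v → ∀ z → c z ≡ c (z ⊕ v)
  periodic-at p (x , y) = p x y

  periodic-cong : ∀ {v w} → v ≡ w → PeriodicOf c v → PeriodicOf c w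
  periodic-cong refl p = p

  periodic-zero : PeriodicOf c (+ 0 , + 0)
  periodic-zero x y = sym (cong₂ (λ a b → c (a , b)) (ℤₚ.+-identityʳ x) (ℤₚ.+-identityʳ y))

  periodic-⊕ : ∀ {v w} → PeriodicOf c v → PeriodicOf c w → PeriodicOf c (v ⊕ w)
  periodic-⊕ {v₁ , v₂} {w₁ , w₂} p q x y = trans (p x y) (trans (q (x + v₁) (y + v₂))
    (cong₂ (λ a b → c (a , b)) (ℤₚ.+-assoc x v₁ w₁) (ℤₚ.+-assoc y v₂ w₂)))

  periodic-neg : ∀ {v₁ v₂} → PeriodicOf c (v₁ , v₂) → PeriodicOf c (- v₁ , - v₂)
  periodic-neg {v₁} {v₂} p x y = sym (trans (p (x - v₁) (y - v₂))
    (cong₂ (λ a b → c (a , b)) (minus-plus x v₁) (minus-plus y v₂)))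
    where
    minus-plus : ∀ a b → a - b + b ≡ a
    minus-plus = solve-∀

  periodic-·ℕ : ∀ {v} → PeriodicOf c v → ∀ k → PeriodicOf c (+ k · v)
  periodic-·ℕ {v₁ , v₂} p zero    = periodic-cong (sym (cong₂ _,_ (ℤₚ.*-zeroˡ v₁) (ℤₚ.*-zeroˡ v₂))) periodic-zero
  periodic-·ℕ {v₁ , v₂} p (suc k) = periodic-cong (cong₂ _,_ (succ (+ k) v₁) (succ (+ k) v₂)) (periodic-⊕ (periodic-·ℕ p k) p)
    where
    succ : ∀ k a → k * a + a ≡ (+ 1 + k) * a
    succ = solve-∀

  periodic-· : ∀ {v} → PeriodicOf c v → ∀ k → PeriodicOf c (k · v)
  periodic-· p (+ k) = periodic-·ℕ p k
  periodic-· {v₁ , v₂} p -[1+ k ] = periodic-cong (cong₂ _,_ (ℤₚ.neg-distribˡ-* (+ suc k) v₁) (ℤₚ.neg-distribˡ-* (+ suc k) v₂))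
    (periodic-neg (periodic-·ℕ p (suc k)))

  vertical-period : ∀ {a b w₁ w₂} → PeriodicOf c (a , b) → PeriodicOf c (w₁ , w₂) →
                    PeriodicOf c (+ 0 , a * w₂ - w₁ * b)
  vertical-period {a} {b} {w₁} {w₂} p q =
    periodic-cong (cong₂ _,_ (cancel a w₁) (minus a b w₁ w₂)) (periodic-⊕ (periodic-· q a) (periodic-· p (- w₁)))
    where
    cancel : ∀ a w₁ → a * w₁ + - w₁ * a ≡ + 0
    cancel = solve-∀
    minus : ∀ a b w₁ w₂ → a * w₂ + - w₁ * b ≡ a * w₂ - w₁ * b
    minus = solve-∀

  NoVerticalPeriod : Set
  NoVerticalPeriod = ∀ d → d ≢ + 0 → ¬ PeriodicOf c (+ 0 , d)

  slope-fin⇒noVerticalPeriod : ∀ {x} → IsSlope c (fin x) → NoVerticalPeriod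
  slope-fin⇒noVerticalPeriod (_ , unique) d d≢0 p
    with unique ∞ ((+ 0 , d) , (λ (_ , d≡0) → d≢0 d≡0) , p , refl)
  ... | ()

  noVerticalPeriod⇒slope : ∀ a b → PeriodicOf c (+ suc a , b) → NoVerticalPeriod → IsSlope c (dir (+ suc a) b)
  noVerticalPeriod⇒slope a b p noVertical = ((+ suc a , b) , (λ { (() , _) }) , p , refl) , unique
    where
    unique : ∀ θ → PeriodicAlong c θ → θ ≡ dir (+ suc a) b
    unique θ ((w₁ , w₂) , w≢0 , q , refl) =
      Equivalence.from (dir-cross w₁ w₂ (+ suc a) b w≢0 (λ { (() , _) })) parallel
      where
      parallel : w₁ * b ≡ w₂ * + suc a
      parallel with + suc a * w₂ - w₁ * b ℤ.≟ + 0
      ... | yes e = sym (trans (ℤₚ.*-comm w₂ (+ suc a)) (ℤₚ.i-j≡0⇒i≡j _ _ e))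
      ... | no ne = ⊥-elim (noVertical _ ne (vertical-period p q))

  periodicAlong⇒multiple : ∀ n q → PeriodicAlong c (dir (+ suc n) q) →
                           ∃ λ m → PeriodicOf c (+ suc m · (+ suc n , q))
  periodicAlong⇒multiple n q ((v₁ , v₂) , v≢0 , p , d≡) =
    go v₁ v₂ v≢0 p (Equivalence.to (dir-cross v₁ v₂ (+ suc n) q v≢0 (λ { (() , _) })) d≡)
    where
    go : ∀ v₁ v₂ → NonZeroVec (v₁ , v₂) → PeriodicOf c (v₁ , v₂) → v₁ * q ≡ v₂ * + suc n →
         ∃ λ m → PeriodicOf c (+ suc m · (+ suc n , q))
    go (+ zero)  v₂ v≢0 _ parallel = ⊥-elim (v≢0 (refl , ℤₚ.*-cancelʳ-≡ v₂ (+ 0) (+ suc n) (sym parallel)))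
    go (+ suc m) v₂ _   p parallel = m , periodic-cong
      (cong₂ _,_ (ℤₚ.*-comm (+ suc n) (+ suc m)) (trans (ℤₚ.*-comm (+ suc n) v₂) (sym parallel)))
      (periodic-· p (+ suc n))
    go -[1+ m ]  v₂ _   p parallel = m , periodic-cong (cong₂ _,_ (neg-neg (+ suc n) (+ suc m)) (begin
      - + suc n * v₂         ≡⟨ neg-comm (+ suc n) v₂ ⟩
      - (v₂ * + suc n)       ≡⟨ cong (λ z → - z) parallel ⟨
      - (-[1+ m ] * q)       ≡⟨ neg-neg-mul (+ suc m) q ⟩
      + suc m * q            ∎)) (periodic-· p (- + suc n))
      where
      open ≡-Reasoning
      neg-neg : ∀ a b → - a * - b ≡ b * a
      neg-neg = solve-∀
      neg-comm : ∀ a b → - a * b ≡ - (b * a)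
      neg-comm = solve-∀
      neg-neg-mul : ∀ a b → - (- a * b) ≡ a * b
      neg-neg-mul = solve-∀

-- Transposition

swapPattern : ∀ {n} → Pattern n → Pattern n
swapPattern P = record { support = List.map swap (support P) ; tileAt = tileAt P ∘ swap }

transpose : TilingSystem → TilingSystem
transpose τ = record { k = k τ ; forbidden = List.map swapPattern (forbidden τ) }

periodic-swap : ∀ {n} (c : ℤ² → Fin n) v → PeriodicOf c v → PeriodicOf (c ∘ swap) (swap v)
periodic-swap c v p x y = p y x

module _ {n} (c : ℤ² → Fin n) where

  appears-swap : ∀ P u → AppearsAt c P u → AppearsAt (c ∘ swap) (swapPattern P) (swap u)
  appears-swap P u ap = Allₚ.map⁺ ap

  appears-swap⁻ : ∀ P u → AppearsAt (c ∘ swap) (swapPattern P) u → AppearsAt c P (swap u)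
  appears-swap⁻ P u ap = Allₚ.map⁻ ap

  isSlope-swap : ∀ {p q} → NonZeroVec (p , q) → IsSlope c (dir p q) → IsSlope (c ∘ swap) (dir q p)
  isSlope-swap pq≢0 ((v , v≢0 , per , dv) , unique) =
    (swap v , v≢0 ∘ swap , periodic-swap c v per , dir-swap v≢0 pq≢0 dv) ,
    λ { _ ((w₁ , w₂) , w≢0 , q , refl) → dir-swap (w≢0 ∘ swap) pq≢0
          (unique (dir w₂ w₁) ((w₂ , w₁) , w≢0 ∘ swap , periodic-swap (c ∘ swap) (w₁ , w₂) q , refl)) }

valid-transpose : ∀ τ {c} → Valid τ c → Valid (transpose τ) (c ∘ swap)
valid-transpose τ {c} valid = Allₚ.map⁺ (All.map (λ {P} ¬ap u ap → ¬ap (swap u) (appears-swap⁻ c P u ap)) valid)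

valid-transpose⁻ : ∀ τ {c} → Valid (transpose τ) c → Valid τ (c ∘ swap)
valid-transpose⁻ τ {c} valid = All.map (λ {P} ¬ap u ap → ¬ap (swap u) (appears-swap (c ∘ swap) P u ap)) (Allₚ.map⁻ valid)

slopes-transpose : ∀ τ {p q} → NonZeroVec (p , q) → Slopes τ (dir p q) ⇔ Slopes (transpose τ) (dir q p)
slopes-transpose τ pq≢0 = mk⇔
  (λ (c , valid , slope) → c ∘ swap , valid-transpose τ {c} valid , isSlope-swap c pq≢0 slope)
  (λ (c , valid , slope) → c ∘ swap , valid-transpose⁻ τ {c} valid , isSlope-swap c (pq≢0 ∘ swap) slope)

-- One-dimensional subshifts of finite type

data Cut (P : ℕ) : ℕ → Set where
  below  : ∀ {n} → n < P → Cut P n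
  beyond : ∀ m → Cut P (P ℕ.+ m)

cut : ∀ P n → Cut P n
cut zero    n       = beyond n
cut (suc P) zero    = below (s≤s z≤n)
cut (suc P) (suc n) with cut P n
... | below n<P = below (s≤s n<P)
... | beyond m  = beyond m

lookup-tabulate-toℕ : ∀ {A : Set} {n} (f : ℕ → A) {m} (m<n : m < n) → lookup (tabulate (f ∘ toℕ)) (fromℕ< m<n) ≡ f m
lookup-tabulate-toℕ f m<n = trans (Vecₚ.lookup∘tabulate (f ∘ toℕ) (fromℕ< m<n)) (cong f (Finₚ.toℕ-fromℕ< m<n))

module _ {A : Set} where

  shift : ℤ → (ℤ → A) → ℤ → A
  shift s h t = h (s + t)

  Periodic : (ℤ → A) → ℤ → Set
  Periodic h d = ∀ s → h (s + d) ≡ h s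

  Aperiodic : (ℤ → A) → Set
  Aperiodic h = ∀ d → d ≢ + 0 → ¬ Periodic h d

  periodic-multipleℕ : ∀ {h d} → Periodic h d → ∀ k s → h (s + + k * d) ≡ h s
  periodic-multipleℕ {h} {d} p zero    s = cong h (trans (cong (λ z → s + z) (ℤₚ.*-zeroˡ d)) (ℤₚ.+-identityʳ s))
  periodic-multipleℕ {h} {d} p (suc k) s = trans (cong h (split s (+ k) d)) (trans (p _) (periodic-multipleℕ p k s))
    where
    split : ∀ s k d → s + (+ 1 + k) * d ≡ s + k * d + d
    split = solve-∀

  periodic-multiple : ∀ {h d} → Periodic h d → ∀ k s → h (s + k * d) ≡ h s
  periodic-multiple p (+ k) s = periodic-multipleℕ p k s
  periodic-multiple {h} {d} p -[1+ k ] s =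
    trans (sym (periodic-multipleℕ p (suc k) (s + -[1+ k ] * d))) (cong h (cancel s (+ k) d))
    where
    cancel : ∀ s k d → s + - (+ 1 + k) * d + (+ 1 + k) * d ≡ s
    cancel = solve-∀

  window : ∀ n → (ℤ → A) → ℤ → Vec A n
  window n h s = tabulate (λ i → h (s + + toℕ i))

  window-≡⇒ : ∀ {n} h s s' → window n h s ≡ window n h s' → ∀ {m} → m < n → h (s + + m) ≡ h (s' + + m)
  window-≡⇒ h s s' eq m<n = begin
    h (s + + _)                               ≡⟨ lookup-tabulate-toℕ (λ j → h (s + + j)) m<n ⟨
    lookup (window _ h s) (fromℕ< m<n)        ≡⟨ cong (λ v → lookup v (fromℕ< m<n)) eq ⟩
    lookup (window _ h s') (fromℕ< m<n)       ≡⟨ lookup-tabulate-toℕ (λ j → h (s' + + j)) m<n ⟩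
    h (s' + + _)                              ∎
    where open ≡-Reasoning

module _ {A : Set} {p : ℕ} where

  cycle : Vec A (suc p) → ℤ → A
  cycle u s = lookup u (fromℕ< (n%ℕd<d s (suc p)))

  cycle-+-multiple : ∀ u s q → cycle u (s + q * + suc p) ≡ cycle u s
  cycle-+-multiple u s q = cong (lookup u) (Finₚ.fromℕ<-cong _ _ ([n+q*d]%ℕd≡n%ℕd (suc p) s q) _ _)

  cycle-periodic : ∀ u → Periodic (cycle u) (+ suc p)
  cycle-periodic u s = trans (cong (λ z → cycle u (s + z)) (sym (ℤₚ.*-identityˡ (+ suc p)))) (cycle-+-multiple u s (+ 1))

  cycle-lookup : ∀ u {n} (n<P : n < suc p) → cycle u (+ n) ≡ lookup u (fromℕ< n<P)
  cycle-lookup u n<P = cong (lookup u) (Finₚ.fromℕ<-cong _ _ (m<n⇒m%n≡m n<P) _ _)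

  cycle-mod : ∀ u s t → cycle u (s + t) ≡ cycle u (+ (s %ℕ suc p) + t)
  cycle-mod u s t = trans (cong (cycle u) (trans (cong (_+ t) (a≡a%ℕn+[a/ℕn]*n s (suc p))) (swap-last (+ (s %ℕ suc p)) (s /ℕ suc p) (+ suc p) t)))
                          (cycle-+-multiple u (+ (s %ℕ suc p) + t) (s /ℕ suc p))
    where
    swap-last : ∀ r q d t → r + q * d + t ≡ r + t + q * d
    swap-last = solve-∀

  cycle-tabulate : ∀ (f : ℤ → A) → Periodic f (+ suc p) → ∀ s → cycle (tabulate (f ∘ +_ ∘ toℕ)) s ≡ f s
  cycle-tabulate f per s = begin
    cycle (tabulate (f ∘ +_ ∘ toℕ)) s          ≡⟨ lookup-tabulate-toℕ (f ∘ +_) (n%ℕd<d s (suc p)) ⟩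
    f (+ (s %ℕ suc p))                         ≡⟨ periodic-multiple per (s /ℕ suc p) _ ⟨
    f (+ (s %ℕ suc p) + s /ℕ suc p * + suc p)  ≡⟨ cong f (a≡a%ℕn+[a/ℕn]*n s (suc p)) ⟨
    f s                                        ∎
    where open ≡-Reasoning

centred : ∀ z R → ℤ.∣ z ∣ ≤ R → ∃ λ n → n ≤ R ℕ.+ R × z ≡ - + R + + n
centred (+ m) R m≤R = R ℕ.+ m , ℕₚ.+-monoʳ-≤ R m≤R , sym (begin
  - + R + + (R ℕ.+ m)  ≡⟨ cong (λ z → - + R + z) (ℤₚ.pos-+ R m) ⟩
  - + R + (+ R + + m)  ≡⟨ cancel (+ R) (+ m) ⟩
  + m                  ∎)
  where
  open ≡-Reasoning
  cancel : ∀ r m → - r + (r + m) ≡ m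
  cancel = solve-∀
centred -[1+ m ] R m<R = R ℕ.∸ suc m , ℕₚ.≤-trans (ℕₚ.m∸n≤m R (suc m)) (ℕₚ.m≤m+n R R) , sym (begin
  - + R + + (R ℕ.∸ suc m)                          ≡⟨ cong (λ z → - + z + + (R ℕ.∸ suc m)) (ℕₚ.m+[n∸m]≡n m<R) ⟨
  - + (suc m ℕ.+ (R ℕ.∸ suc m)) + + (R ℕ.∸ suc m)  ≡⟨ cong (λ z → - z + + (R ℕ.∸ suc m)) (ℤₚ.pos-+ (suc m) _) ⟩
  - (+ suc m + + (R ℕ.∸ suc m)) + + (R ℕ.∸ suc m)  ≡⟨ cancel (+ suc m) (+ (R ℕ.∸ suc m)) ⟩
  -[1+ m ]                                         ∎)
  where
  open ≡-Reasoning
  cancel : ∀ s n → - (s + n) + n ≡ - s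
  cancel = solve-∀

record LocalRule : Set₁ where
  field
    Symbol        : Set
    _≟_           : DecidableEquality Symbol
    symbols       : List Symbol
    ∈-symbols     : ∀ a → a ∈ symbols
    radius        : ℕ
    Allowed       : (ℤ → Symbol) → Set
    allowed?      : ∀ h → Dec (Allowed h)
    allowed-local : ∀ h h' → (∀ z → ℤ.∣ z ∣ ≤ radius → h z ≡ h' z) → Allowed h → Allowed h'

module Admissibility (ρ : LocalRule) where
  open LocalRule ρ

  span : ℕ
  span = radius ℕ.+ radius

  Admissible : (ℤ → Symbol) → Set
  Admissible h = ∀ s → Allowed (shift s h)

  allowed-cong : ∀ {h h'} → (∀ t → h t ≡ h' t) → Allowed h → Allowed h'
  allowed-cong h≗h' = allowed-local _ _ (λ z _ → h≗h' z)

  allowed-window : ∀ h h' s s' → (∀ n → n ≤ span → h (s + (- + radius + + n)) ≡ h' (s' + (- + radius + + n))) →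
                   Allowed (shift s h) → Allowed (shift s' h')
  allowed-window h h' s s' agree = allowed-local _ _ λ z |z|≤R → case centred z radius |z|≤R of λ
    (n , n≤span , z≡) → subst (λ t → h (s + t) ≡ h' (s' + t)) (sym z≡) (agree n n≤span)

  admissible-cong : ∀ {h h'} → (∀ t → h t ≡ h' t) → Admissible h → Admissible h'
  admissible-cong h≗h' adm s = allowed-cong (λ t → h≗h' _) (adm s)

  admissible-shift : ∀ {h} c → Admissible h → Admissible (shift c h)
  admissible-shift {h} c adm s = allowed-cong (λ t → cong h (ℤₚ.+-assoc c s t)) (adm (c + s))

  CyclicAllowed : ∀ {p} → Vec Symbol (suc p) → Set
  CyclicAllowed {p} u = ∀ (i : Fin (suc p)) → Allowed (shift (+ toℕ i) (cycle u))

  cyclicAllowed? : ∀ {p} (u : Vec Symbol (suc p)) → Dec (CyclicAllowed u)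
  cyclicAllowed? u = Finₚ.all? (λ i → allowed? _)

  cyclicAllowed⇒admissible : ∀ {p} (u : Vec Symbol (suc p)) → CyclicAllowed u → Admissible (cycle u)
  cyclicAllowed⇒admissible {p} u allowed s = allowed-cong (λ t → sym (cycle-mod u s t))
    (subst (λ j → Allowed (shift (+ j) (cycle u))) (Finₚ.toℕ-fromℕ< (n%ℕd<d s (suc p))) (allowed _))

  module _ {p : ℕ} where
    private
      P : ℕ
      P = suc p
      M : ℕ
      M = suc span

    cycle-agrees : ∀ (h : ℤ → Symbol) a → window M h a ≡ window M h (a + + P) →
                   ∀ n → n < P ℕ.+ M → cycle (window P h a) (+ n) ≡ h (a + + n)
    cycle-agrees h a windows≡ = <-rec (λ n → n < P ℕ.+ M → cycle (window P h a) (+ n) ≡ h (a + + n)) agrees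
      where
      agrees : ∀ n → (∀ {m} → m < n → m < P ℕ.+ M → cycle (window P h a) (+ m) ≡ h (a + + m)) →
               n < P ℕ.+ M → cycle (window P h a) (+ n) ≡ h (a + + n)
      agrees n rec n<P+M with cut P n
      ... | below n<P = trans (cycle-lookup (window P h a) n<P) (lookup-tabulate-toℕ (λ j → h (a + + j)) n<P)
      ... | beyond m  = begin
        cycle (window P h a) (+ (P ℕ.+ m))  ≡⟨ cong (cycle (window P h a)) (trans (ℤₚ.pos-+ P m) (ℤₚ.+-comm (+ P) (+ m))) ⟩
        cycle (window P h a) (+ m + + P)    ≡⟨ cycle-periodic (window P h a) (+ m) ⟩
        cycle (window P h a) (+ m)          ≡⟨ rec (ℕₚ.m<n+m m (s≤s z≤n)) (ℕₚ.<-≤-trans m<M (ℕₚ.m≤n+m M P)) ⟩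
        h (a + + m)                         ≡⟨ window-≡⇒ h a (a + + P) windows≡ m<M ⟩
        h (a + + P + + m)                   ≡⟨ cong h (trans (ℤₚ.+-assoc a (+ P) (+ m)) (cong (λ z → a + z) (sym (ℤₚ.pos-+ P m)))) ⟩
        h (a + + (P ℕ.+ m))                 ∎
        where
        open ≡-Reasoning
        m<M : m < M
        m<M = ℕₚ.+-cancelˡ-< P m M n<P+M

    cycle-admissible : ∀ {h} a (u : Vec Symbol P) → Admissible h →
                       (∀ n → n < P ℕ.+ M → cycle u (+ n) ≡ h (a + + n)) → Admissible (cycle u)
    cycle-admissible {h} a u adm agree s = allowed-window h (cycle u) centre s matches (adm centre)
      where
      r : ℕ
      r = (s - + radius) %ℕ P
      centre : ℤ
      centre = a + + r + + radius
      matches : ∀ n → n ≤ span → h (centre + (- + radius + + n)) ≡ cycle u (s + (- + radius + + n))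
      matches n n≤span = sym (begin
        cycle u (s + (- + radius + + n))                   ≡⟨ cong (cycle u) (regroup s (+ radius) (+ n)) ⟩
        cycle u (s - + radius + + n)                       ≡⟨ cycle-mod u (s - + radius) (+ n) ⟩
        cycle u (+ r + + n)                                ≡⟨ cong (cycle u) (sym (ℤₚ.pos-+ r n)) ⟩
        cycle u (+ (r ℕ.+ n))                              ≡⟨ agree (r ℕ.+ n) (ℕₚ.+-mono-<-≤ (n%ℕd<d (s - + radius) P) (ℕₚ.m≤n⇒m≤1+n n≤span)) ⟩
        h (a + + (r ℕ.+ n))                                ≡⟨ cong h (trans (cong (λ z → a + z) (ℤₚ.pos-+ r n)) (recentre a (+ r) (+ radius) (+ n))) ⟩
        h (centre + (- + radius + + n))                    ∎)
        where
        open ≡-Reasoning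
        regroup : ∀ s R n → s + (- R + n) ≡ s - R + n
        regroup = solve-∀
        recentre : ∀ a r R n → a + (r + n) ≡ a + r + R + (- R + n)
        recentre = solve-∀

-- Aperiodic points and their finite witnesses

pos-minus-larger : ∀ a N → a < N → ∃ λ e → a ℕ.+ suc e ≡ N × + a - + N ≡ -[1+ e ]
pos-minus-larger a N a<N = N ℕ.∸ suc a , a+suc[e]≡N ,
  trans (cong (λ z → + a - + z) (sym (ℕₚ.m+[n∸m]≡n a<N))) (cancel (+ a) (+ (N ℕ.∸ suc a)))
  where
  a+suc[e]≡N : a ℕ.+ suc (N ℕ.∸ suc a) ≡ N
  a+suc[e]≡N = trans (ℕₚ.+-suc a _) (ℕₚ.m+[n∸m]≡n a<N)
  cancel : ∀ a e → a - (+ 1 + a + e) ≡ - (+ 1 + e)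
  cancel = solve-∀

private
  window-left-end : ∀ x R n e → n ℕ.+ e ≡ R ℕ.+ R → x + (- + R + + n) ≡ x + + R - + e
  window-left-end x R n e n+e≡2R = begin
    x + (- + R + + n)                         ≡⟨ regroup x (+ R) (+ n) (+ e) ⟩
    x + + R - + e + (+ n + + e - (+ R + + R)) ≡⟨ cong (λ z → x + + R - + e + z) (ℤₚ.i≡j⇒i-j≡0 n+e≡R+R) ⟩
    x + + R - + e + + 0                       ≡⟨ ℤₚ.+-identityʳ _ ⟩
    x + + R - + e                             ∎
    where
    open ≡-Reasoning
    regroup : ∀ x R n e → x + (- R + n) ≡ x + R - e + (n + e - (R + R))
    regroup = solve-∀
    n+e≡R+R : + n + + e ≡ + R + + R
    n+e≡R+R = trans (sym (ℤₚ.pos-+ n e)) (trans (cong +_ n+e≡2R) (ℤₚ.pos-+ R R))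

  window-left-negative : ∀ R s j n → s + + R ≡ -[1+ j ] → n ≤ R ℕ.+ R → ∃ λ k → s + (- + R + + n) ≡ -[1+ k ]
  window-left-negative R s j n e n≤2R = m ℕ.+ j , (begin
    s + (- + R + + n)  ≡⟨ window-left-end s R n m (ℕₚ.m+[n∸m]≡n n≤2R) ⟩
    s + + R - + m      ≡⟨ cong (_- + m) e ⟩
    -[1+ j ] - + m     ≡⟨ ℤₚ.neg-minus-pos j m ⟩
    -[1+ m ℕ.+ j ]     ∎)
    where
    open ≡-Reasoning
    m : ℕ
    m = R ℕ.+ R ℕ.∸ n

  window-right-position : ∀ R L s j n → s + + R ≡ + (L ℕ.+ (R ℕ.+ R) ℕ.+ j) → s + (- + R + + n) ≡ + (L ℕ.+ (j ℕ.+ n))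
  window-right-position R L s j n e = begin
    s + (- + R + + n)                            ≡⟨ regroup s (+ R) (+ n) ⟩
    s + + R - (+ R + + R) + + n                  ≡⟨ cong (λ z → z - (+ R + + R) + + n) (trans e (pos-+³ L (R ℕ.+ R) j)) ⟩
    + L + + (R ℕ.+ R) + + j - (+ R + + R) + + n  ≡⟨ cong (λ z → + L + z + + j - (+ R + + R) + + n) (ℤₚ.pos-+ R R) ⟩
    + L + (+ R + + R) + + j - (+ R + + R) + + n  ≡⟨ cancel (+ L) (+ R + + R) (+ j) (+ n) ⟩
    + L + (+ j + + n)                            ≡⟨ cong (λ z → + L + z) (ℤₚ.pos-+ j n) ⟨
    + L + + (j ℕ.+ n)                            ≡⟨ ℤₚ.pos-+ L (j ℕ.+ n) ⟨
    + (L ℕ.+ (j ℕ.+ n))                          ∎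
    where
    open ≡-Reasoning
    regroup : ∀ s R n → s + (- R + n) ≡ s + R - (R + R) + n
    regroup = solve-∀
    cancel : ∀ L W j n → L + W + j - W + n ≡ L + (j + n)
    cancel = solve-∀
    pos-+³ : ∀ a b c → + (a ℕ.+ b ℕ.+ c) ≡ + a + + b + + c
    pos-+³ a b c = trans (ℤₚ.pos-+ (a ℕ.+ b) c) (cong (_+ + c) (ℤₚ.pos-+ a b))

  negative-multiple : ∀ d → d ≢ + 0 → ∀ N → ∃ λ k → ∃ λ m → k * d ≡ - + (N ℕ.* suc m)
  negative-multiple (+ zero)  d≢0 N = ⊥-elim (d≢0 refl)
  negative-multiple (+ suc m) _   N = - + N , m , trans (sym (ℤₚ.neg-distribˡ-* (+ N) (+ suc m))) (cong (λ z → - z) (sym (ℤₚ.pos-* N (suc m))))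
  negative-multiple -[1+ m ]  _   N = + N , m , trans (sym (ℤₚ.neg-distribʳ-* (+ N) (+ suc m))) (cong (λ z → - z) (sym (ℤₚ.pos-* N (suc m))))

module Splicing (ρ : LocalRule) where
  open LocalRule ρ
  open Admissibility ρ

  Deviates : ∀ {p L} → Vec Symbol (suc p) → Vec Symbol L → Set
  Deviates {L = L} u v = ∃ λ (r : Fin L) → lookup v r ≢ cycle u (+ toℕ r)

  module _ {p L q : ℕ} (u : Vec Symbol (suc p)) (v : Vec Symbol L) (w : Vec Symbol (suc q)) where

    -- The sequence ⋯ u u u v w w w ⋯, with v at the positions 0 … L - 1.
    splice : ℤ → Symbol
    splice -[1+ n ] = cycle u -[1+ n ]
    splice (+ n) with n ℕ.<? L
    ... | yes n<L = lookup v (fromℕ< n<L)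
    ... | no _    = cycle w (+ (n ℕ.∸ L))

    splice-middle : ∀ {n} (n<L : n < L) → splice (+ n) ≡ lookup v (fromℕ< n<L)
    splice-middle {n} n<L with n ℕ.<? L
    ... | yes _  = refl
    ... | no n≮L = ⊥-elim (n≮L n<L)

    splice-right : ∀ m → splice (+ (L ℕ.+ m)) ≡ cycle w (+ m)
    splice-right m with L ℕ.+ m ℕ.<? L
    ... | yes L+m<L = ⊥-elim (ℕₚ.m+n≮m L m L+m<L)
    ... | no _      = cong (λ j → cycle w (+ j)) (ℕₚ.m+n∸m≡n L m)

    MiddleAllowed : Set
    MiddleAllowed = ∀ (i : Fin (L ℕ.+ span)) → Allowed (shift (- + radius + + toℕ i) splice)

    Splicing : Set
    Splicing = CyclicAllowed u × CyclicAllowed w × MiddleAllowed × Deviates u v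

    splicing? : Dec Splicing
    splicing? = cyclicAllowed? u ×-dec cyclicAllowed? w ×-dec Finₚ.all? (λ _ → allowed? _)
                ×-dec Finₚ.any? (λ r → ¬? (lookup v r ≟ cycle u (+ toℕ r)))

    splice-admissible : Splicing → Admissible splice
    splice-admissible (left , right , middle , _) s with s + + radius in e
    ... | -[1+ j ] = allowed-window (cycle u) splice s s agree (cyclicAllowed⇒admissible u left s)
      where
      agree : ∀ n → n ≤ span → cycle u (s + (- + radius + + n)) ≡ splice (s + (- + radius + + n))
      agree n n≤span with window-left-negative radius s j n e n≤span
      ... | _ , negative = trans (cong (cycle u) negative) (sym (cong splice negative))
    ... | + n with cut (L ℕ.+ span) n
    ...   | below n<L+span = subst (λ z → Allowed (shift z splice)) (sym s≡)
                               (subst (λ j → Allowed (shift (- + radius + + j) splice)) (Finₚ.toℕ-fromℕ< n<L+span) (middle _))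
      where
      s≡ : s ≡ - + radius + + n
      s≡ = trans (recentre s (+ radius)) (cong (λ z → - + radius + z) e)
        where
        recentre : ∀ s R → s ≡ - R + (s + R)
        recentre = solve-∀
    ...   | beyond j = allowed-window (cycle w) splice (+ j + + radius) s agree
                         (cyclicAllowed⇒admissible w right (+ j + + radius))
      where
      agree : ∀ n → n ≤ span → cycle w (+ j + + radius + (- + radius + + n)) ≡ splice (s + (- + radius + + n))
      agree n _ = begin
        cycle w (+ j + + radius + (- + radius + + n)) ≡⟨ cong (cycle w) (trans (cancel (+ j) (+ radius) (+ n)) (sym (ℤₚ.pos-+ j n))) ⟩
        cycle w (+ (j ℕ.+ n))                         ≡⟨ splice-right (j ℕ.+ n) ⟨
        splice (+ (L ℕ.+ (j ℕ.+ n)))                  ≡⟨ cong splice (window-right-position radius L s j n e) ⟨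
        splice (s + (- + radius + + n))               ∎
        where
        open ≡-Reasoning
        cancel : ∀ j R n → j + R + (- R + n) ≡ j + n
        cancel = solve-∀

    -- A multiple of the period d that is also a multiple of |u| carries r into the left part.
    splice-aperiodic : Deviates u v → Aperiodic splice
    splice-aperiodic (r , deviates) d d≢0 periodic with negative-multiple d d≢0 (suc (toℕ r) ℕ.* suc p)
    ... | k , m , kd≡ with pos-minus-larger (toℕ r) (suc (toℕ r) ℕ.* suc p ℕ.* suc m) far
      where
      far : toℕ r < suc (toℕ r) ℕ.* suc p ℕ.* suc m
      far = ℕₚ.<-≤-trans (ℕₚ.n<1+n (toℕ r)) (ℕₚ.≤-trans (ℕₚ.m≤m*n (suc (toℕ r)) (suc p)) (ℕₚ.m≤m*n _ (suc m)))
    ... | e , _ , negative = deviates (begin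
      lookup v r                              ≡⟨ cong (lookup v) (Finₚ.fromℕ<-toℕ r (Finₚ.toℕ<n r)) ⟨
      lookup v (fromℕ< (Finₚ.toℕ<n r))        ≡⟨ splice-middle (Finₚ.toℕ<n r) ⟨
      splice (+ toℕ r)                        ≡⟨ periodic-multiple periodic k (+ toℕ r) ⟨
      splice (+ toℕ r + k * d)                ≡⟨ cong splice left ⟩
      cycle u -[1+ e ]                        ≡⟨ cong (cycle u) left ⟨
      cycle u (+ toℕ r + k * d)               ≡⟨ cong (λ z → cycle u (+ toℕ r + z)) kd≡q*P ⟩
      cycle u (+ toℕ r + quotient * + suc p)  ≡⟨ cycle-+-multiple u (+ toℕ r) quotient ⟩
      cycle u (+ toℕ r)                       ∎)
      where
      open ≡-Reasoning
      quotient : ℤ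
      quotient = - + (suc (toℕ r) ℕ.* suc m)
      kd≡q*P : k * d ≡ quotient * + suc p
      kd≡q*P = begin
        k * d                                          ≡⟨ kd≡ ⟩
        - + (suc (toℕ r) ℕ.* suc p ℕ.* suc m)          ≡⟨ cong (λ z → - + z) (right-comm (suc (toℕ r)) (suc p) (suc m)) ⟩
        - + (suc (toℕ r) ℕ.* suc m ℕ.* suc p)          ≡⟨ cong (λ z → - z) (ℤₚ.pos-* (suc (toℕ r) ℕ.* suc m) (suc p)) ⟩
        - (+ (suc (toℕ r) ℕ.* suc m) * + suc p)        ≡⟨ ℤₚ.neg-distribˡ-* (+ (suc (toℕ r) ℕ.* suc m)) (+ suc p) ⟩
        quotient * + suc p                             ∎
        where
        right-comm : ∀ a b c → a ℕ.* b ℕ.* c ≡ a ℕ.* c ℕ.* b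
        right-comm = ℕ-Solver.solve-∀
      left : + toℕ r + k * d ≡ -[1+ e ]
      left = trans (cong (λ z → + toℕ r + z) kd≡) negative

vectors : ∀ {A : Set} → List A → ∀ n → List (Vec A n)
vectors xs zero    = Vec.[] ∷ []
vectors xs (suc n) = List.cartesianProductWith Vec._∷_ xs (vectors xs n)

∈-vectors : ∀ {A : Set} {xs : List A} → (∀ x → x ∈ xs) → ∀ {n} (v : Vec A n) → v ∈ vectors xs n
∈-vectors complete Vec.[]       = here refl
∈-vectors complete (x Vec.∷ v)  = ∈-cartesianProductWith⁺ Vec._∷_ (complete x) (∈-vectors complete v)

Σ-enumerated? : ∀ {A : Set} {P : A → Set} (xs : List A) → (∀ x → x ∈ xs) → (∀ x → Dec (P x)) → Dec (Σ A P)
Σ-enumerated? xs complete P? with Any.any? P? xs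
... | yes found = yes (Any.satisfied found)
... | no ¬found = no λ (x , px) → ¬found (Any.map (λ { refl → px }) (complete x))

pigeonhole : ∀ {A : Set} (xs : List A) → (∀ x → x ∈ xs) → (f : ℕ → A) →
             ∃ λ m₁ → ∃ λ m₂ → m₁ < m₂ × m₂ ≤ length xs × f m₁ ≡ f m₂
pigeonhole xs complete f with Finₚ.pigeonhole (ℕₚ.n<1+n (length xs)) (λ i → Any.index (complete (f (toℕ i))))
... | i , j , i<j , same-index = toℕ i , toℕ j , i<j , ℕₚ.≤-pred (Finₚ.toℕ<n j) ,
  Membershipₛ.index-injective (setoid _) (complete _) (complete _) same-index

module Witnesses (ρ : LocalRule) where
  open LocalRule ρ
  open Admissibility ρ
  open Splicing ρ

  windowCount : ℕ
  windowCount = length (vectors symbols (suc span))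

  -- Windows of length span + 1 repeat within windowCount steps, which bounds the blocks of the
  -- witnesses built in Deviation.
  bound : ℕ
  bound = windowCount ℕ.+ windowCount ℕ.+ 2

  private
    Bounded : Set
    Bounded = Fin (suc bound)

  Witness : Set
  Witness = Σ Bounded λ p → Σ Bounded λ L → Σ Bounded λ q →
            Σ (Vec Symbol (suc (toℕ p))) λ u → Σ (Vec Symbol (toℕ L)) λ v → Σ (Vec Symbol (suc (toℕ q))) λ w →
            Splicing u v w

  witness? : Dec Witness
  witness? = Finₚ.any? λ p → Finₚ.any? λ L → Finₚ.any? λ q →
             Σ-enumerated? _ (∈-vectors ∈-symbols) λ u →
             Σ-enumerated? _ (∈-vectors ∈-symbols) λ v →
             Σ-enumerated? _ (∈-vectors ∈-symbols) λ w → splicing? u v w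

  witness-sound : Witness → ∃ λ h → Admissible h × Aperiodic h
  witness-sound (_ , _ , _ , u , v , w , splicing@(_ , _ , _ , deviates)) =
    splice u v w , splice-admissible u v w splicing , splice-aperiodic u v w deviates

  mkWitness : ∀ {p L q} → p ≤ bound → L ≤ bound → q ≤ bound →
              (u : Vec Symbol (suc p)) (v : Vec Symbol L) (w : Vec Symbol (suc q)) → Splicing u v w → Witness
  mkWitness p≤ L≤ q≤ = pack (fromℕ< (s≤s p≤)) (fromℕ< (s≤s L≤)) (fromℕ< (s≤s q≤))
    (Finₚ.toℕ-fromℕ< (s≤s p≤)) (Finₚ.toℕ-fromℕ< (s≤s L≤)) (Finₚ.toℕ-fromℕ< (s≤s q≤))
    where
    pack : ∀ (i j k : Bounded) {p L q} → toℕ i ≡ p → toℕ j ≡ L → toℕ k ≡ q →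
           (u : Vec Symbol (suc p)) (v : Vec Symbol L) (w : Vec Symbol (suc q)) → Splicing u v w → Witness
    pack i j k refl refl refl u v w splicing = i , j , k , u , v , w , splicing

pos-+-minus : ∀ m k → + (m ℕ.+ k) - + m ≡ + k
pos-+-minus m k = trans (cong (_- + m) (ℤₚ.pos-+ m k)) (cancel (+ m) (+ k))
  where
  cancel : ∀ m k → m + k - m ≡ k
  cancel = solve-∀

least : ∀ {P : ℕ → Set} → (∀ n → Dec (P n)) → ∀ {n₀} → P n₀ → ∃ λ n → P n × (∀ {m} → m < n → ¬ P m)
least P? {zero}   p₀ = zero , p₀ , λ ()
least P? {suc n₀} p₀ with P? zero
... | yes p = zero , p , λ ()
... | no ¬p with least (P? ∘ suc) {n₀} p₀
...   | n , pn , minimal = suc n , pn , λ { {zero} _ → ¬p ; {suc m} (s≤s m<n) → minimal m<n }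

module Deviation (ρ : LocalRule) where
  open LocalRule ρ
  open Admissibility ρ
  open Splicing ρ
  open Witnesses ρ

  -- h agrees with the periodic g on [a, a + n₁) and not at a + n₁. A period of g just before n₁,
  -- the block of h from there to a window of h that repeats after n₁, and the period of h given by
  -- that repetition form a witness.
  module _ (h : ℤ → Symbol) (h-admissible : Admissible h) (g : ℤ → Symbol) (g-admissible : Admissible g)
           {p} (p≤N : p ≤ windowCount) (g-periodic : Periodic g (+ suc p)) (a : ℤ)
           (agree : ∀ n → n < suc p ℕ.+ suc span → g (a + + n) ≡ h (a + + n))
           {n₀} (deviation : h (a + + n₀) ≢ g (a + + n₀)) where

    private
      P : ℕ
      P = suc p
      M : ℕ
      M = suc span

      at : ℕ → ℤ
      at n = a + + n

      at-+ : ∀ x y → at x + + y ≡ at (x ℕ.+ y)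
      at-+ x y = trans (ℤₚ.+-assoc a (+ x) (+ y)) (cong (λ z → a + z) (sym (ℤₚ.pos-+ x y)))

      first : ∃ λ n → h (at n) ≢ g (at n) × (∀ {m} → m < n → ¬ h (at m) ≢ g (at m))
      first = least (λ n → ¬? (h (at n) ≟ g (at n))) deviation
      n₁ : ℕ
      n₁ = proj₁ first

      differs : h (at n₁) ≢ g (at n₁)
      differs = proj₁ (proj₂ first)

      agrees-before : ∀ {m} → m < n₁ → h (at m) ≡ g (at m)
      agrees-before m<n₁ = decidable-stable (h (at _) ≟ g (at _)) (proj₂ (proj₂ first) m<n₁)

      P+M≤n₁ : P ℕ.+ M ≤ n₁
      P+M≤n₁ = ℕₚ.≮⇒≥ λ n₁<P+M → differs (sym (agree n₁ n₁<P+M))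

      b : ℕ
      b = n₁ ℕ.∸ P

      b+P≡n₁ : b ℕ.+ P ≡ n₁
      b+P≡n₁ = ℕₚ.m∸n+n≡m (ℕₚ.≤-trans (ℕₚ.m≤m+n P M) P+M≤n₁)

      M≤b : M ≤ b
      M≤b = ℕₚ.+-cancelʳ-≤ P M b (subst (M ℕ.+ P ≤_) (sym b+P≡n₁) (subst (_≤ n₁) (ℕₚ.+-comm P M) P+M≤n₁))

      repeat : ∃ λ m₁ → ∃ λ m₂ → m₁ < m₂ × m₂ ≤ windowCount ×
                     window M h (at (n₁ ℕ.+ suc m₁)) ≡ window M h (at (n₁ ℕ.+ suc m₂))
      repeat = pigeonhole (vectors symbols M) (∈-vectors ∈-symbols) (λ m → window M h (at (n₁ ℕ.+ suc m)))
      m₁ : ℕ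
      m₁ = proj₁ repeat
      m₂ : ℕ
      m₂ = proj₁ (proj₂ repeat)

      m₁<m₂ : m₁ < m₂
      m₁<m₂ = proj₁ (proj₂ (proj₂ repeat))

      m₂≤N : m₂ ≤ windowCount
      m₂≤N = proj₁ (proj₂ (proj₂ (proj₂ repeat)))

      q : ℕ
      q = m₂ ℕ.∸ suc m₁
      Q : ℕ
      Q = suc q
      L : ℕ
      L = P ℕ.+ suc m₂
      t : ℤ
      t = at (n₁ ℕ.+ suc m₁)

      t+Q≡ : t + + Q ≡ at (n₁ ℕ.+ suc m₂)
      t+Q≡ = trans (at-+ (n₁ ℕ.+ suc m₁) Q) (cong at (trans (ℕₚ.+-assoc n₁ (suc m₁) Q)
               (cong (n₁ ℕ.+_) (trans (ℕₚ.+-suc (suc m₁) q) (cong suc (ℕₚ.m+[n∸m]≡n m₁<m₂))))))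

      windows≡ : window M h t ≡ window M h (t + + Q)
      windows≡ = trans (proj₂ (proj₂ (proj₂ (proj₂ repeat)))) (cong (window M h) (sym t+Q≡))

      u : Vec Symbol P
      u = window P h (at b)
      v : Vec Symbol L
      v = window L h (at b)
      w : Vec Symbol Q
      w = window Q h t

      cycle-u : ∀ z → cycle u z ≡ g (at b + z)
      cycle-u z = trans (cong (λ x → cycle x z) (Vecₚ.tabulate-cong λ i → h≡g (Finₚ.toℕ<n i)))
                        (cycle-tabulate (shift (at b) g) shifted-periodic z)
        where
        h≡g : ∀ {k} → k < P → h (at b + + k) ≡ g (at b + + k)
        h≡g {k} k<P = subst (λ z → h z ≡ g z) (sym (at-+ b k))
                        (agrees-before (subst (b ℕ.+ k <_) b+P≡n₁ (ℕₚ.+-monoʳ-< b k<P)))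
        shifted-periodic : Periodic (shift (at b) g) (+ P)
        shifted-periodic s = trans (cong g (sym (ℤₚ.+-assoc (at b) s (+ P)))) (g-periodic (at b + s))

      cycle-w : ∀ n → n < Q ℕ.+ M → cycle w (+ n) ≡ h (t + + n)
      cycle-w = cycle-agrees h t windows≡

      left-allowed : CyclicAllowed u
      left-allowed i = admissible-cong {shift (at b) g} (λ z → sym (cycle-u z)) (admissible-shift {g} (at b) g-admissible) (+ toℕ i)

      right-allowed : CyclicAllowed w
      right-allowed i = cycle-admissible {h = h} t w h-admissible cycle-w (+ toℕ i)

      splice-left : ∀ {x} → x < span → splice u v w (+ x - + span) ≡ h (at b + (+ x - + span))
      splice-left {x} x<span with pos-minus-larger x span x<span
      ... | e , x+suc[e]≡span , x-span≡ rewrite x-span≡ = begin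
        cycle u -[1+ e ]         ≡⟨ cycle-u -[1+ e ] ⟩
        g (at b + -[1+ e ])      ≡⟨ cong g at-c ⟩
        g (at c)                 ≡⟨ agrees-before c<n₁ ⟨
        h (at c)                 ≡⟨ cong h at-c ⟨
        h (at b + -[1+ e ])      ∎
        where
        open ≡-Reasoning
        e<b : suc e ≤ b
        e<b = ℕₚ.≤-trans (ℕₚ.≤-trans (ℕₚ.m≤n+m (suc e) x) (ℕₚ.≤-reflexive x+suc[e]≡span)) (ℕₚ.≤-trans (ℕₚ.n≤1+n span) M≤b)
        c : ℕ
        c = b ℕ.∸ suc e
        at-c : at b + -[1+ e ] ≡ at c
        at-c = trans (cong (λ z → at z + -[1+ e ]) (sym (ℕₚ.m∸n+n≡m e<b)))
                (trans (cong (_+ -[1+ e ]) (sym (at-+ c (suc e)))) (cancel (at c) (+ suc e)))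
          where
          cancel : ∀ x s → x + s + - s ≡ x
          cancel = solve-∀
        c<n₁ : c < n₁
        c<n₁ = ℕₚ.<-≤-trans (ℕₚ.∸-monoʳ-< (s≤s z≤n) e<b) (subst (b ≤_) b+P≡n₁ (ℕₚ.m≤m+n b P))

      splice-centre : ∀ {k} (k<L : k < L) → splice u v w (+ k) ≡ h (at b + + k)
      splice-centre k<L = trans (splice-middle u v w k<L) (lookup-tabulate-toℕ (λ j → h (at b + + j)) k<L)

      splice-right-matches : ∀ {j} → j < span → splice u v w (+ (L ℕ.+ j)) ≡ h (at b + + (L ℕ.+ j))
      splice-right-matches {j} j<span = begin
        splice u v w (+ (L ℕ.+ j))   ≡⟨ splice-right u v w j ⟩
        cycle w (+ j)               ≡⟨ cycle-w j (ℕₚ.<-≤-trans j<M (ℕₚ.m≤n+m M Q)) ⟩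
        h (t + + j)                 ≡⟨ window-≡⇒ h t (t + + Q) windows≡ j<M ⟩
        h (t + + Q + + j)           ≡⟨ cong h (trans (cong (_+ + j) t+Q≡) (trans (at-+ _ j) (cong at positions))) ⟩
        h (at (b ℕ.+ (L ℕ.+ j)))     ≡⟨ cong h (at-+ b (L ℕ.+ j)) ⟨
        h (at b + + (L ℕ.+ j))       ∎
        where
        open ≡-Reasoning
        j<M : j < M
        j<M = ℕₚ.<-trans j<span (ℕₚ.n<1+n span)
        positions : n₁ ℕ.+ suc m₂ ℕ.+ j ≡ b ℕ.+ (L ℕ.+ j)
        positions = trans (cong (λ n → n ℕ.+ suc m₂ ℕ.+ j) (sym b+P≡n₁)) (reassoc b P (suc m₂) j)
          where
          reassoc : ∀ b P m j → b ℕ.+ P ℕ.+ m ℕ.+ j ≡ b ℕ.+ (P ℕ.+ m ℕ.+ j)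
          reassoc = ℕ-Solver.solve-∀

      splice-matches : ∀ x → x < L ℕ.+ span ℕ.+ span → splice u v w (+ x - + span) ≡ h (at b + (+ x - + span))
      splice-matches x x< with cut span x
      ... | below x<span = splice-left x<span
      ... | beyond k rewrite pos-+-minus span k with cut L k
      ...   | below k<L = splice-centre k<L
      ...   | beyond j  = splice-right-matches (ℕₚ.+-cancelˡ-< (L ℕ.+ span) j span (subst (_< L ℕ.+ span ℕ.+ span) (reorder span L j) x<))
        where
        reorder : ∀ s L j → s ℕ.+ (L ℕ.+ j) ≡ L ℕ.+ s ℕ.+ j
        reorder = ℕ-Solver.solve-∀

      middle-allowed : MiddleAllowed u v w
      middle-allowed i = allowed-window h (splice u v w) (at b + (- + radius + + toℕ i)) (- + radius + + toℕ i)
                           matches (h-admissible (at b + (- + radius + + toℕ i)))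
        where
        centred-sum : ∀ n → - + radius + + toℕ i + (- + radius + + n) ≡ + (toℕ i ℕ.+ n) - + span
        centred-sum n = trans (regroup (+ radius) (+ toℕ i) (+ n))
                          (cong₂ (λ x y → x - y) (sym (ℤₚ.pos-+ (toℕ i) n)) (sym (ℤₚ.pos-+ radius radius)))
          where
          regroup : ∀ R i n → - R + i + (- R + n) ≡ i + n - (R + R)
          regroup = solve-∀
        matches : ∀ n → n ≤ span → h (at b + (- + radius + + toℕ i) + (- + radius + + n)) ≡
                                 splice u v w (- + radius + + toℕ i + (- + radius + + n))
        matches n n≤span = begin
          h (at b + (- + radius + + toℕ i) + (- + radius + + n))  ≡⟨ cong h (trans (ℤₚ.+-assoc (at b) _ _) (cong (λ z → at b + z) (centred-sum n))) ⟩
          h (at b + (+ (toℕ i ℕ.+ n) - + span))                  ≡⟨ splice-matches (toℕ i ℕ.+ n) (ℕₚ.+-mono-<-≤ (Finₚ.toℕ<n i) n≤span) ⟨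
          splice u v w (+ (toℕ i ℕ.+ n) - + span)                 ≡⟨ cong (splice u v w) (centred-sum n) ⟨
          splice u v w (- + radius + + toℕ i + (- + radius + + n)) ∎
          where open ≡-Reasoning

      deviates : Deviates u v
      deviates = fromℕ< P<L , λ same → differs (begin
        h (at n₁)                          ≡⟨ cong h at-P ⟨
        h (at b + + P)                     ≡⟨ lookup-tabulate-toℕ (λ j → h (at b + + j)) P<L ⟨
        lookup v (fromℕ< P<L)              ≡⟨ same ⟩
        cycle u (+ toℕ (fromℕ< P<L))       ≡⟨ cong (λ j → cycle u (+ j)) (Finₚ.toℕ-fromℕ< P<L) ⟩
        cycle u (+ P)                      ≡⟨ cycle-u (+ P) ⟩
        g (at b + + P)                     ≡⟨ cong g at-P ⟩
        g (at n₁)                          ∎)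
        where
        open ≡-Reasoning
        P<L : P < L
        P<L = ℕₚ.m<m+n P (s≤s z≤n)
        at-P : at b + + P ≡ at n₁
        at-P = trans (at-+ b P) (cong at b+P≡n₁)

      N≤bound : windowCount ≤ bound
      N≤bound = ℕₚ.≤-trans (ℕₚ.m≤m+n windowCount windowCount) (ℕₚ.m≤m+n _ 2)

      L≤bound : L ≤ bound
      L≤bound = subst (L ≤_) (two-more windowCount) (ℕₚ.+-mono-≤ (s≤s p≤N) (s≤s m₂≤N))
        where
        two-more : ∀ N → suc N ℕ.+ suc N ≡ N ℕ.+ N ℕ.+ 2
        two-more = ℕ-Solver.solve-∀

    right-deviation-witness : Witness
    right-deviation-witness = mkWitness (ℕₚ.≤-trans p≤N N≤bound) L≤bound
      (ℕₚ.≤-trans (ℕₚ.m∸n≤m m₂ (suc m₁)) (ℕₚ.≤-trans m₂≤N N≤bound)) u v w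
      (left-allowed , right-allowed , middle-allowed , deviates)

reflect : ∀ {A : Set} → (ℤ → A) → ℤ → A
reflect h t = h (- t)

reverse : LocalRule → LocalRule
reverse ρ = record ρ
  { Allowed       = Allowed ∘ reflect
  ; allowed?      = allowed? ∘ reflect
  ; allowed-local = λ h h' agree → allowed-local (reflect h) (reflect h')
                      λ z |z|≤r → agree (- z) (subst (_≤ radius) (sym (ℤₚ.∣-i∣≡∣i∣ z)) |z|≤r)
  }
  where open LocalRule ρ

module Reversal (ρ : LocalRule) where
  open LocalRule ρ
  open Admissibility ρ
  private module Rev = Admissibility (reverse ρ)

  reflect-admissible : ∀ h → Admissible h → Rev.Admissible (reflect h)
  reflect-admissible h admissible s = allowed-cong (λ t → cong h (neg-shift s t)) (admissible (- s))
    where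
    neg-shift : ∀ s t → - s + t ≡ - (s + - t)
    neg-shift = solve-∀

  reflect-admissible⁻ : ∀ x → Rev.Admissible x → Admissible (reflect x)
  reflect-admissible⁻ x admissible s = allowed-cong (λ t → cong x (neg-shift s t)) (admissible (- s))
    where
    neg-shift : ∀ s t → - s + - t ≡ - (s + t)
    neg-shift = solve-∀

reflect-periodic : ∀ {A : Set} {g : ℤ → A} {d} → Periodic g d → Periodic (reflect g) d
reflect-periodic {g = g} {d} periodic s = trans (sym (periodic (- (s + d)))) (cong g (cancel s d))
  where
  cancel : ∀ s d → - (s + d) + d ≡ - s
  cancel = solve-∀

reflect-aperiodic : ∀ {A : Set} {x : ℤ → A} → Aperiodic x → Aperiodic (reflect x)
reflect-aperiodic {x = x} aperiodic d d≢0 periodic = aperiodic (- d) (d≢0 ∘ ℤₚ.neg-injective) λ s →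
  trans (cong x (neg-minus s d)) (trans (periodic (- s)) (cong x (ℤₚ.neg-involutive s)))
  where
  neg-minus : ∀ s d → s - d ≡ - (- s + d)
  neg-minus = solve-∀

module Decision (ρ : LocalRule) where
  open LocalRule ρ
  open Admissibility ρ
  open Witnesses ρ
  open Deviation ρ
  open Reversal ρ
  private
    module Rev = Witnesses (reverse ρ)
    M : ℕ
    M = suc span

  -- A witness for the reversed rule covers deviations to the left of the periodic approximation.
  AperiodicWitness : Set
  AperiodicWitness = Witness ⊎ Rev.Witness

  aperiodicWitness? : Dec AperiodicWitness
  aperiodicWitness? = witness? ⊎-dec Rev.witness?

  aperiodicWitness-sound : AperiodicWitness → ∃ λ h → Admissible h × Aperiodic h
  aperiodicWitness-sound (inj₁ witness) = witness-sound witness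
  aperiodicWitness-sound (inj₂ witness) = case Rev.witness-sound witness of λ
    (x , admissible , aperiodic) → reflect x , reflect-admissible⁻ x admissible , reflect-aperiodic aperiodic

  module _ (h : ℤ → Symbol) (h-admissible : Admissible h) where
    private
      repeat : ∃ λ m₁ → ∃ λ m₂ → m₁ < m₂ × m₂ ≤ windowCount × window M h (+ m₁) ≡ window M h (+ m₂)
      repeat = pigeonhole (vectors symbols M) (∈-vectors ∈-symbols) (λ m → window M h (+ m))
      m₁ : ℕ
      m₁ = proj₁ repeat
      m₂ : ℕ
      m₂ = proj₁ (proj₂ repeat)

      m₁<m₂ : m₁ < m₂
      m₁<m₂ = proj₁ (proj₂ (proj₂ repeat))

      p : ℕ
      p = m₂ ℕ.∸ suc m₁
      P : ℕ
      P = suc p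
      K : ℕ
      K = p ℕ.+ M
      a : ℤ
      a = + m₁

      p≤N : p ≤ windowCount
      p≤N = ℕₚ.≤-trans (ℕₚ.m∸n≤m m₂ (suc m₁)) (proj₁ (proj₂ (proj₂ (proj₂ repeat))))

      windows≡ : window M h a ≡ window M h (a + + P)
      windows≡ = trans (proj₂ (proj₂ (proj₂ (proj₂ repeat)))) (cong (window M h) (sym a+P≡m₂))
        where
        a+P≡m₂ : a + + P ≡ + m₂
        a+P≡m₂ = trans (sym (ℤₚ.pos-+ m₁ P)) (cong +_ (trans (ℕₚ.+-suc m₁ p) (ℕₚ.m+[n∸m]≡n m₁<m₂)))

      u : Vec Symbol P
      u = window P h a

      g : ℤ → Symbol
      g = shift (- a) (cycle u)

      g-agrees : ∀ n → n < P ℕ.+ M → g (a + + n) ≡ h (a + + n)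
      g-agrees n n< = trans (cong (cycle u) (cancel a (+ n))) (cycle-agrees h a windows≡ n n<)
        where
        cancel : ∀ a n → - a + (a + n) ≡ n
        cancel = solve-∀

      g-periodic : Periodic g (+ P)
      g-periodic s = trans (cong (cycle u) (sym (ℤₚ.+-assoc (- a) s (+ P)))) (cycle-periodic u (- a + s))

      g-admissible : Admissible g
      g-admissible = admissible-shift {cycle u} (- a) (cycle-admissible {h = h} a u h-admissible (cycle-agrees h a windows≡))

      mirror : ∀ n → n ≤ K → - (- (a + + K) + + n) ≡ a + + (K ℕ.∸ n)
      mirror n n≤K = trans (reflect-sum a (+ K) (+ n)) (cong (λ z → a + z) (trans (ℤₚ.[+m]-[+n]≡m⊖n K n) (ℤₚ.⊖-≥ n≤K)))
        where
        reflect-sum : ∀ a K n → - (- (a + K) + n) ≡ a + (K - n)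
        reflect-sum = solve-∀

      reflected-agrees : ∀ n → n < P ℕ.+ M → reflect g (- (a + + K) + + n) ≡ reflect h (- (a + + K) + + n)
      reflected-agrees n n< = trans (cong g (mirror n (ℕₚ.≤-pred n<)))
        (trans (g-agrees (K ℕ.∸ n) (s≤s (ℕₚ.m∸n≤m K n))) (cong h (sym (mirror n (ℕₚ.≤-pred n<)))))

      recentre : ∀ a s → s ≡ a + (s - a)
      recentre = solve-∀

      deviation-witness : ∀ s → h s ≢ g s → AperiodicWitness
      deviation-witness s h≢g with s - a in e
      ... | + n₀     = inj₁ (right-deviation-witness h h-admissible g g-admissible p≤N g-periodic a g-agrees
                               (subst (λ z → h z ≢ g z) (trans (recentre a s) (cong (λ z → a + z) e)) h≢g))
      ... | -[1+ k ] = inj₂ (Deviation.right-deviation-witness (reverse ρ) (reflect h) (reflect-admissible h h-admissible)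
                               (reflect g) (reflect-admissible g g-admissible) p≤N (reflect-periodic g-periodic)
                               (- (a + + K)) reflected-agrees (subst (λ z → h z ≢ g z) (sym reflected) h≢g))
        where
        cancel : ∀ a K s → - (- (a + K) + (K + s)) ≡ a + - s
        cancel = solve-∀
        reflected : - (- (a + + K) + + (K ℕ.+ suc k)) ≡ s
        reflected = trans (cong (λ z → - (- (a + + K) + z)) (ℤₚ.pos-+ K (suc k)))
                      (trans (cancel a (+ K) (+ suc k)) (sym (trans (recentre a s) (cong (λ z → a + z) e))))

    -- Locating a point where h leaves its periodic approximation g is not constructive; the double
    -- negation is removed later by deciding AperiodicWitness.
    aperiodicWitness-complete : Aperiodic h → ¬ ¬ AperiodicWitness
    aperiodicWitness-complete aperiodic no-witness = aperiodic (+ P) (λ ()) h-periodic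
      where
      h≡g : ∀ s → h s ≡ g s
      h≡g s = decidable-stable (h s ≟ g s) (λ h≢g → no-witness (deviation-witness s h≢g))
      h-periodic : Periodic h (+ P)
      h-periodic s = trans (h≡g (s + + P)) (trans (g-periodic s) (sym (h≡g s)))

-- Periodic tilings as sequences of rows

≤-max-map : ∀ {X : Set} (f : X → ℕ) {xs x} → x ∈ xs → f x ≤ max 0 (List.map f xs)
≤-max-map f x∈xs = All.lookup (xs≤max 0 (List.map f _)) (∈-map⁺ f x∈xs)

appears-cong : ∀ {n} (c c' : ℤ² → Fin n) {P} u u' → (∀ x → c (u ⊕ x) ≡ c' (u' ⊕ x)) →
               AppearsAt c P u → AppearsAt c' P u'
appears-cong c c' u u' same = All.map (trans (sym (same _)))

appears? : ∀ {n} (c : ℤ² → Fin n) P u → Dec (AppearsAt c P u)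
appears? c P u = All.all? (λ x → c (u ⊕ x) Finₚ.≟ tileAt P x) (support P)

valid-cong : ∀ τ {c c' : Tiling τ} → (∀ z → c z ≡ c' z) → Valid τ c → Valid τ c'
valid-cong τ {c} {c'} c≗c' = All.map (λ ¬appears u → ¬appears u ∘ appears-cong c' c u u (λ x → sym (c≗c' (u ⊕ x))))

module Encoding (τ : TilingSystem) (a : ℕ) (b : ℤ) where

  A : ℕ
  A = suc a

  Row : Set
  Row = Vec (Fin (k τ)) A

  -- Cell (r + q A , y) with 0 ≤ r < A is entry r of row y - q b.
  tiling : (ℤ → Row) → Tiling τ
  tiling h (x , y) = lookup (h (y - b * (x /ℕ A))) (fromℕ< (n%ℕd<d x A))

  rows : Tiling τ → ℤ → Row
  rows c y = tabulate (λ i → c (+ toℕ i , y))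

  module _ (h : ℤ → Row) where

    tiling-translate : ∀ x y q → tiling h (x + q * + A , y + q * b) ≡ tiling h (x , y)
    tiling-translate x y q = cong₂ lookup
      (cong h (trans (cong (λ z → y + q * b - b * z) ([n+q*d]/ℕd≡n/ℕd+q A x q)) (cancel y q b (x /ℕ A))))
      (Finₚ.fromℕ<-cong _ _ ([n+q*d]%ℕd≡n%ℕd A x q) _ _)
      where
      cancel : ∀ y q b d → y + q * b - b * (d + q) ≡ y - b * d
      cancel = solve-∀

    tiling-periodic : PeriodicOf (tiling h) (+ A , b)
    tiling-periodic x y = sym (trans
      (cong₂ (λ u v → tiling h (u , v)) (cong (λ z → x + z) (sym (ℤₚ.*-identityˡ (+ A)))) (cong (λ z → y + z) (sym (ℤₚ.*-identityˡ b))))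
      (tiling-translate x y (+ 1)))

    tiling-column : ∀ {i} (i<A : i < A) y → tiling h (+ i , y) ≡ lookup (h y) (fromℕ< i<A)
    tiling-column {i} i<A y = cong₂ lookup
      (cong h (trans (cong (λ z → y - b * + z) (m<n⇒m/n≡0 i<A)) (times-zero y b)))
      (Finₚ.fromℕ<-cong _ _ (m<n⇒m%n≡m i<A) _ _)
      where
      times-zero : ∀ y b → y - b * + 0 ≡ y
      times-zero = solve-∀

    tiling-shift : ∀ s x y → tiling (shift s h) (x , y) ≡ tiling h (x , s + y)
    tiling-shift s x y = cong (λ z → lookup (h z) (fromℕ< (n%ℕd<d x A))) (sym (ℤₚ.+-assoc s y _))

    tiling-vertical : ∀ {d} → Periodic h d → PeriodicOf (tiling h) (+ 0 , d)
    tiling-vertical {d} periodic x y = sym (trans (cong (λ z → tiling h (z , y + d)) (ℤₚ.+-identityʳ x))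
      (cong (λ z → lookup z (fromℕ< (n%ℕd<d x A))) (trans (cong h (swap-right y d _)) (periodic _))))
      where
      swap-right : ∀ y d c → y + d - c ≡ y - c + d
      swap-right = solve-∀

    rows-tiling : ∀ y → rows (tiling h) y ≡ h y
    rows-tiling y = trans (Vecₚ.tabulate-cong column) (Vecₚ.tabulate∘lookup (h y))
      where
      column : ∀ i → tiling h (+ toℕ i , y) ≡ lookup (h y) i
      column i = trans (tiling-column (Finₚ.toℕ<n i) y) (cong (lookup (h y)) (Finₚ.fromℕ<-toℕ i (Finₚ.toℕ<n i)))

    vertical-periodic : ∀ {d} → PeriodicOf (tiling h) (+ 0 , d) → Periodic h d
    vertical-periodic {d} vertical y = begin
      h (y + d)                  ≡⟨ rows-tiling (y + d) ⟨
      rows (tiling h) (y + d)    ≡⟨ Vecₚ.tabulate-cong (λ i → trans (cong (λ x → tiling h (x , y + d)) (sym (ℤₚ.+-identityʳ (+ toℕ i)))) (sym (vertical (+ toℕ i) y))) ⟩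
      rows (tiling h) y          ≡⟨ rows-tiling y ⟩
      h y                        ∎
      where open ≡-Reasoning

  tiling-rows : ∀ c → PeriodicOf c (+ A , b) → ∀ z → tiling (rows c) z ≡ c z
  tiling-rows c periodic (x , y) = begin
    tiling (rows c) (x , y)                         ≡⟨ lookup-tabulate-toℕ (λ i → c (+ i , y - b * q)) (n%ℕd<d x A) ⟩
    c (+ (x %ℕ A) , y - b * q)                      ≡⟨ periodic-at c (periodic-· c periodic q) (+ (x %ℕ A) , y - b * q) ⟩
    c (+ (x %ℕ A) + q * + A , y - b * q + q * b)    ≡⟨ cong₂ (λ u v → c (u , v)) (sym (a≡a%ℕn+[a/ℕn]*n x A)) (cancel y b q) ⟩
    c (x , y)                                       ∎
    where
    open ≡-Reasoning
    q : ℤ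
    q = x /ℕ A
    cancel : ∀ y b q → y - b * q + q * b ≡ y
    cancel = solve-∀

  row-offset : Fin A → ℤ² → ℤ
  row-offset i (x₁ , x₂) = + 0 + x₂ - b * ((+ toℕ i + x₁) /ℕ A)

  -- How far from row 0 an occurrence of a forbidden pattern at (i , 0), i < A, can reach.
  reach : ℕ
  reach = max 0 (List.map (λ P → max 0 (List.map (λ i → max 0 (List.map (ℤ.∣_∣ ∘ row-offset i) (support P)))
                                                 (List.allFin A)))
                          (forbidden τ))

  row-offset≤reach : ∀ {P} → P ∈ forbidden τ → ∀ i {x} → x ∈ support P → ℤ.∣ row-offset i x ∣ ≤ reach
  row-offset≤reach P∈ i x∈ = ℕₚ.≤-trans (≤-max-map _ x∈) (ℕₚ.≤-trans (≤-max-map _ (∈-allFin i)) (≤-max-map _ P∈))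

  NoForbiddenOnRow : (ℤ → Row) → Set
  NoForbiddenOnRow h = All (λ P → ∀ (i : Fin A) → ¬ AppearsAt (tiling h) P (+ toℕ i , + 0)) (forbidden τ)

  rule : LocalRule
  rule = record
    { Symbol        = Row
    ; _≟_           = Vecₚ.≡-dec Finₚ._≟_
    ; symbols       = vectors (List.allFin (k τ)) A
    ; ∈-symbols     = ∈-vectors ∈-allFin
    ; radius        = reach
    ; Allowed       = NoForbiddenOnRow
    ; allowed?      = λ h → All.all? (λ P → Finₚ.all? λ i → ¬? (appears? (tiling h) P (+ toℕ i , + 0))) (forbidden τ)
    ; allowed-local = λ h h' agree allowed → All.tabulate λ {P} P∈ i appears' → All.lookup allowed P∈ i
                        (All.tabulate λ {x} x∈ → trans (cong (λ r → lookup r _) (agree _ (row-offset≤reach P∈ i x∈)))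
                                                       (All.lookup appears' x∈))
    }

  open Admissibility rule using (Admissible)

  admissible⇒valid : ∀ h → Admissible h → Valid τ (tiling h)
  admissible⇒valid h admissible = All.tabulate λ {P} P∈ (u₁ , u₂) appears →
    All.lookup (admissible (u₂ - b * (u₁ /ℕ A))) P∈ (fromℕ< (n%ℕd<d u₁ A))
      (appears-cong (tiling h) (tiling (shift (u₂ - b * (u₁ /ℕ A)) h)) (u₁ , u₂) (+ toℕ (fromℕ< (n%ℕd<d u₁ A)) , + 0)
                    (moved u₁ u₂) appears)
    where
    moved : ∀ u₁ u₂ x → tiling h ((u₁ , u₂) ⊕ x) ≡ tiling (shift (u₂ - b * (u₁ /ℕ A)) h) ((+ toℕ (fromℕ< (n%ℕd<d u₁ A)) , + 0) ⊕ x)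
    moved u₁ u₂ (x₁ , x₂) = sym (begin
      tiling (shift s h) (+ r + x₁ , + 0 + x₂)               ≡⟨ tiling-shift h s (+ r + x₁) (+ 0 + x₂) ⟩
      tiling h (+ r + x₁ , s + (+ 0 + x₂))                   ≡⟨ tiling-translate h (+ r + x₁) (s + (+ 0 + x₂)) q ⟨
      tiling h (+ r + x₁ + q * + A , s + (+ 0 + x₂) + q * b) ≡⟨ cong₂ (λ u v → tiling h (u , v)) first second ⟩
      tiling h (u₁ + x₁ , u₂ + x₂)                           ∎)
      where
      open ≡-Reasoning
      q : ℤ
      q = u₁ /ℕ A
      r : ℕ
      r = toℕ (fromℕ< (n%ℕd<d u₁ A))
      s : ℤ
      s = u₂ - b * q
      first : + r + x₁ + q * + A ≡ u₁ + x₁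
      first = trans (swap-last (+ r) x₁ (q * + A)) (cong (_+ x₁) (sym (trans (a≡a%ℕn+[a/ℕn]*n u₁ A)
                (cong (λ z → + z + q * + A) (sym (Finₚ.toℕ-fromℕ< (n%ℕd<d u₁ A)))))))
        where
        swap-last : ∀ r x m → r + x + m ≡ r + m + x
        swap-last = solve-∀
      second : s + (+ 0 + x₂) + q * b ≡ u₂ + x₂
      second = cancel u₂ b q x₂
        where
        cancel : ∀ u b q x → u - b * q + (+ 0 + x) + q * b ≡ u + x
        cancel = solve-∀

  valid⇒admissible : ∀ h → Valid τ (tiling h) → Admissible h
  valid⇒admissible h valid s = All.tabulate λ {P} P∈ i appears → All.lookup valid P∈ (+ toℕ i , s)
    (appears-cong (tiling (shift s h)) (tiling h) (+ toℕ i , + 0) (+ toℕ i , s) (λ (x₁ , x₂) → trans (tiling-shift h s (+ toℕ i + x₁) (+ 0 + x₂))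
                                       (cong (λ z → tiling h (+ toℕ i + x₁ , s + z)) (ℤₚ.+-identityˡ x₂))) appears)

  rows-admissible : ∀ c → PeriodicOf c (+ A , b) → Valid τ c → Admissible (rows c)
  rows-admissible c periodic valid = valid⇒admissible (rows c) (valid-cong τ (λ z → sym (tiling-rows c periodic z)) valid)

  rows-aperiodic : ∀ c → PeriodicOf c (+ A , b) → NoVerticalPeriod c → Aperiodic (rows c)
  rows-aperiodic c periodic noVertical d d≢0 rows-periodic = noVertical d d≢0 λ x y →
    trans (sym (tiling-rows c periodic (x , y))) (trans (tiling-vertical (rows c) rows-periodic x y) (tiling-rows c periodic _))

  tiling-slope : ∀ h → Aperiodic h → IsSlope (tiling h) (dir (+ A) b)
  tiling-slope h aperiodic = noVerticalPeriod⇒slope (tiling h) a b (tiling-periodic h)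
    λ d d≢0 vertical → aperiodic d d≢0 (vertical-periodic h vertical)

-- Semi-deciding the slopes

semidecision : ∀ {S : Set} {W : ℕ → Set} (W? : ∀ m → Dec (W m)) →
               (S → ∃ λ m → ¬ ¬ W m) → (∃ W → S) → S ⇔ ∃ λ m → does (W? m) ≡ true
semidecision W? complete sound = mk⇔
  (λ s → case complete s of λ (m , ¬¬w) → m , dec-true (W? m) (decidable-stable (W? m) ¬¬w))
  (λ (m , accepted) → sound (m , accepted-witness (W? m) accepted))
  where
  accepted-witness : ∀ {A : Set} (a? : Dec A) → does a? ≡ true → A
  accepted-witness (yes a) _ = a

-- A tiling has slope q/(n+1) iff it has a period (m+1)·(n+1, q) whose sequence of rows is aperiodic.
module PositiveDirection (τ : TilingSystem) (n : ℕ) (q : ℤ) where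
  private
    module E (m : ℕ) = Encoding τ (n ℕ.+ m ℕ.* suc n) (+ suc m * q)
    module D (m : ℕ) = Decision (E.rule m)

  witness? : ∀ m → Dec (D.AperiodicWitness m)
  witness? m = D.aperiodicWitness? m

  slope⇒witness : Slopes τ (dir (+ suc n) q) → ∃ λ m → ¬ ¬ D.AperiodicWitness m
  slope⇒witness (c , valid , slope) = case periodicAlong⇒multiple c n q (proj₁ slope) of λ
    (m , periodic) → m , D.aperiodicWitness-complete m (E.rows m c) (E.rows-admissible m c periodic valid)
                           (E.rows-aperiodic m c periodic (slope-fin⇒noVerticalPeriod c slope))

  witness⇒slope : ∃ D.AperiodicWitness → Slopes τ (dir (+ suc n) q)
  witness⇒slope (m , witness) = case D.aperiodicWitness-sound m witness of λ
    (h , admissible , aperiodic) → E.tiling m h , E.admissible⇒valid m h admissible ,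
                                   subst (IsSlope (E.tiling m h)) (dir-scale m n q) (E.tiling-slope m h aperiodic)

  slopes⇔witness : Slopes τ (dir (+ suc n) q) ⇔ ∃ λ m → does (witness? m) ≡ true
  slopes⇔witness = semidecision witness? slope⇒witness witness⇒slope

open PositiveDirection

-- dir -[1+ n ] q is dir (+ suc n) (- q) by definition.
slopeSemidecider : TilingSystem → ℤ → ℤ → ℕ → Bool
slopeSemidecider τ (+ suc n) q         m = does (witness? τ n q m)
slopeSemidecider τ -[1+ n ]  q         m = does (witness? τ n (- q) m)
slopeSemidecider τ (+ zero)  (+ suc n) m = does (witness? (transpose τ) n (+ 0) m)
slopeSemidecider τ (+ zero)  -[1+ n ]  m = does (witness? (transpose τ) n (+ 0) m)
slopeSemidecider τ (+ zero)  (+ zero)  m = false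

mainTheorem2 : (τ : TilingSystem) → RecEnum (Slopes τ)
mainTheorem2 τ = slopeSemidecider τ , λ where
  (+ suc n) q         _  → slopes⇔witness τ n q
  -[1+ n ]  q         _  → slopes⇔witness τ n (- q)
  (+ zero)  (+ suc n) pq≢0 → ⇔.trans (slopes-transpose τ pq≢0) (slopes⇔witness (transpose τ) n (+ 0))
  (+ zero)  -[1+ n ]  pq≢0 → ⇔.trans (slopes-transpose τ pq≢0) (slopes⇔witness (transpose τ) n (+ 0))
  (+ zero)  (+ zero)  pq≢0 → ⊥-elim (pq≢0 (refl , refl))
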